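{- In the Maker–Breaker game on the infinite grid whose winning sets are all isomorphic copies of the polyomino Snaky, Breaker has no winning pairing strategy; i.e., there is no family of pairwise disjoint 2-element subsets of $\mathbb Z^2$ such that every isomorphic copy of Snaky contains one of these pairs.
   Context: Cells of the infinite square grid are identified with their lower-left lattice points $(x,y)\in\mathbb Z^2$. Snaky is the hexomino $S=\{(0,1),(1,1),(1,0),(2,0),(3,0),(4,0)\}$ (two "head" cells above a "body" of four consecutive cells, the head overlapping the first body cell and protruding one cell beyond it). An isomorphic copy of Snaky is the image of $S$ under a composition of a translation with one of the 8 rotations/reflections of the square grid. In the Maker–Breaker game the players alternately take cells; Maker wins by owning all cells of some winning set. -}

module Defs where

open import Data.Bool.Base using (Bool; true; false)
open import Data.Fin.Base using (Fin)
open import Data.Fin.Patterns using (0F; 1F; 2F; 3F)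
open import Data.Integer.Base using (ℤ; +_; -_; _+_)
open import Data.List.Base using (List; []; _∷_)
open import Data.List.Membership.Propositional using (_∈_)
open import Data.Product.Base using (_×_; _,_; ∃; ∃-syntax)
open import Function.Base using (_∘_)
open import Level using (Level; 0ℓ; suc; _⊔_)
open import Relation.Binary.PropositionalEquality using (_≡_; _≢_)
open import Relation.Nullary.Negation using (¬_)
open import Relation.Unary using (Pred; ｛_｝; _∪_; _⊆_; _≐_; _⊥_)

-- Subsets of X are predicates, compared extensionally by _≐_;
-- _⊥_ is disjointness.

Subset : Set → Set₁
Subset X = Pred X 0ℓ

Family : Set → (ℓ : Level) → Set (suc 0ℓ ⊔ suc ℓ)
Family X ℓ = Pred (Subset X) ℓ

module _ {X : Set} where

  IsTwoElement : Subset X → Set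
  IsTwoElement P = ∃[ a ] ∃[ b ] (a ≢ b × P ≐ ｛ a ｝ ∪ ｛ b ｝)

  -- Members that are the same set up to _≐_ count as one member.
  PairwiseDisjoint : ∀ {ℓ} → Family X ℓ → Set (suc 0ℓ ⊔ ℓ)
  PairwiseDisjoint 𝓟 = ∀ P Q → 𝓟 P → 𝓟 Q → ¬ (P ≐ Q) → P ⊥ Q

  -- Breaker answers a Maker move in a pair by taking the other element of
  -- that pair; this blocks every winning set when each contains a pair.
  record IsWinningPairing {w ℓ} (𝓦 : Family X w) (𝓟 : Family X ℓ) : Set (suc 0ℓ ⊔ w ⊔ ℓ) where
    field
      twoElement       : ∀ P → 𝓟 P → IsTwoElement P
      pairwiseDisjoint : PairwiseDisjoint 𝓟
      hits             : ∀ W → 𝓦 W → ∃[ P ] (𝓟 P × P ⊆ W)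

  HasWinningPairing : ∀ {w} (ℓ : Level) → Family X w → Set (suc 0ℓ ⊔ w ⊔ suc ℓ)
  HasWinningPairing ℓ 𝓦 = ∃ λ (𝓟 : Family X ℓ) → IsWinningPairing 𝓦 𝓟

  image : (X → X) → Subset X → Subset X
  image f A y = ∃[ x ] (A x × y ≡ f x)

Cell : Set
Cell = ℤ × ℤ

translate : Cell → Cell → Cell
translate (u , v) (x , y) = (u + x , v + y)

rotate : Fin 4 → Cell → Cell
rotate 0F (x , y) = (x , y)
rotate 1F (x , y) = (- y , x)
rotate 2F (x , y) = (- x , - y)
rotate 3F (x , y) = (y , - x)

reflect : Bool → Cell → Cell
reflect false (x , y) = (x , y)
reflect true  (x , y) = (- x , y)

-- The maps rotate k ∘ reflect r are the 8 symmetries of the square grid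
-- fixing the origin. Acting on lower-left corners instead of whole unit
-- squares changes the result only by a translation.
IsIsomorphicCopy : Subset Cell → Family Cell 0ℓ
IsIsomorphicCopy A W =
  ∃[ t ] ∃[ k ] ∃[ r ] W ≐ image (translate t ∘ rotate k ∘ reflect r) A

snakyCells : List Cell
snakyCells =
  (+ 0 , + 1) ∷ (+ 1 , + 1) ∷
  (+ 1 , + 0) ∷ (+ 2 , + 0) ∷ (+ 3 , + 0) ∷ (+ 4 , + 0) ∷ []

Snaky : Subset Cell
Snaky = _∈ snakyCells

-- The 80 copies of Snaky inside a 6 × 6 board already suffice. Committing to a
-- pair {a, b} of partners discharges the copies containing both cells and
-- deletes a and b from all others, so branching over the pairs inside a
-- shortest remaining list refutes the pairing as soon as every branch leaves
-- some list with fewer than two cells. The search from the full set of copies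
-- is large, but it is small once two adjacent cells near the middle of the board
-- are assumed to be partners. As the board may be placed anywhere, this excludes
-- all dominoes as pairs, and without dominoes the search is small again.

module Submission where

open import Algebra.Bundles using (module AbelianGroup)
import Data.Integer.Properties as ℤ
open import Algebra.Properties.Group (AbelianGroup.group ℤ.+-0-abelianGroup)
  using (∙-cancelˡ; //-rightDividesˡ)
open import Data.Bool.Base using (Bool; true; false; T; if_then_else_)
open import Data.Bool.Properties using (T-≡)
open import Data.Bool.ListAction using (all)
open import Data.Empty using (⊥-elim)
open import Data.Fin.Base using (Fin)
open import Data.Integer.Base using (+_; ∣_∣) renaming (_-_ to _-ᶻ_)
open import Data.List.Base
  using (List; []; _∷_; _++_; allFin; cartesianProduct; filter; length; map; upTo)
open import Data.List.Membership.Propositional using (_∈_)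
open import Data.List.Membership.Propositional.Properties
  using (∈-filter⁺; ∈-map⁺; ∈-++⁺ˡ; ∈-++⁺ʳ)
open import Data.List.Relation.Unary.All as All using (All; []; _∷_; all?)
open import Data.List.Relation.Unary.All.Properties using (all⁺; all-filter; map⁺)
open import Data.List.Relation.Unary.Any using (here; there)
open import Data.Nat.Base using (ℕ; zero; suc; _+_; _*_; _/_; _%_; _<_; _<ᵇ_; _≡ᵇ_)
open import Data.Nat.DivMod using (m≡m%n+[m/n]*n)
import Data.Nat.Properties as ℕ
open import Data.Product.Base using (_×_; _,_; ∃-syntax; proj₁; proj₂)
open import Data.Product.Properties using (≡-dec; ,-injective)
open import Data.Sum.Base using (_⊎_; inj₁; inj₂)
open import Data.Unit.Base using (⊤; tt)
open import Defs
open import Function.Base using (_∘_)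
open import Function.Bundles using (module Equivalence)
open import Level using (Level; _⊔_; 0ℓ) renaming (suc to lsuc)
open import Relation.Binary.Core using (Rel)
open import Relation.Binary.Definitions
  using (Decidable; DecidableEquality; Irreflexive; Symmetric)
open import Relation.Binary.PropositionalEquality
  using (_≡_; _≢_; refl; sym; trans; cong; cong₂; subst)
open import Relation.Nullary.Decidable
  using (yes; ¬?; _×-dec_; _⊎-dec_; decidable-stable)
open import Relation.Nullary.Negation using (¬_)
import Relation.Unary as U

open Equivalence using (to; from)

-- Search over lists of cell codes

elem : ℕ → List ℕ → Bool
elem x []       = false
elem x (y ∷ ys) = if x ≡ᵇ y then true else elem x ys

remove : ℕ → List ℕ → List ℕ
remove x []       = []
remove x (y ∷ ys) = if x ≡ᵇ y then ys else y ∷ remove x ys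

pairs : List ℕ → List (ℕ × ℕ)
pairs []       = []
pairs (x ∷ xs) = map (x ,_) xs ++ pairs xs

shortest : List ℕ → List (List ℕ) → List ℕ
shortest w []       = w
shortest w (v ∷ vs) = shortest (if length v <ᵇ length w then v else w) vs

commit : ℕ → ℕ → List (List ℕ) → List (List ℕ)
commit a b []       = []
commit a b (w ∷ ws) =
  if elem a w
  then (if elem b w then commit a b ws else remove a w ∷ commit a b ws)
  -- This also covers lists with neither cell, which `remove` leaves unchanged.
  else remove b w ∷ commit a b ws

-- R holds between any two cells not yet excluded as partners; the number
-- bounds the depth of the search.
module _ {r} {R : Rel ℕ r} (R? : Decidable R) where

  refuted : ℕ → List (List ℕ) → Bool
  refuted zero    _        = false
  refuted (suc n) []       = false
  refuted (suc n) (w ∷ ws) =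
    -- A list with no admissible pair closes the branch, since `all` over no pairs is `true`.
    all (λ (a , b) → refuted n (commit a b (w ∷ ws)))
        (filter (λ (a , b) → R? a b) (pairs (shortest w ws)))

∈⇒elem : ∀ {x ys} → x ∈ ys → T (elem x ys)
∈⇒elem {x} {y ∷ ys} x∈ with x ≡ᵇ y in eq
... | true = tt
∈⇒elem {x} (here refl) | false = ⊥-elim (subst T eq (ℕ.≡⇒≡ᵇ x x refl))
∈⇒elem     (there x∈)  | false = ∈⇒elem x∈

∈-remove⁺ : ∀ {x c ys} → c ∈ ys → c ≢ x → c ∈ remove x ys
∈-remove⁺ {x} {c} {y ∷ ys} c∈ c≢x with x ≡ᵇ y in eq
∈-remove⁺ (here refl) c≢x | true = ⊥-elim (c≢x (sym (ℕ.≡ᵇ⇒≡ _ _ (subst T (sym eq) tt))))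
∈-remove⁺ (there c∈)  c≢x | true  = c∈
∈-remove⁺ (here refl) c≢x | false = here refl
∈-remove⁺ (there c∈)  c≢x | false = there (∈-remove⁺ c∈ c≢x)

-- `pairs` offers each pair of positions in one order only, hence the two cases.
∈-pairs⁺ : ∀ {c d ws} → c ∈ ws → d ∈ ws → c ≢ d → (c , d) ∈ pairs ws ⊎ (d , c) ∈ pairs ws
∈-pairs⁺ (here refl) (here refl) c≢d = ⊥-elim (c≢d refl)
∈-pairs⁺ (here refl) (there d∈)  c≢d = inj₁ (∈-++⁺ˡ (∈-map⁺ _ d∈))
∈-pairs⁺ (there c∈)  (here refl) c≢d = inj₂ (∈-++⁺ˡ (∈-map⁺ _ c∈))
∈-pairs⁺ {ws = w ∷ ws} (there c∈) (there d∈) c≢d with ∈-pairs⁺ c∈ d∈ c≢d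
... | inj₁ cd∈ = inj₁ (∈-++⁺ʳ (map (w ,_) ws) cd∈)
... | inj₂ dc∈ = inj₂ (∈-++⁺ʳ (map (w ,_) ws) dc∈)

shortest⁺ : ∀ {p} {P : U.Pred (List ℕ) p} {w ws} → P w → All P ws → P (shortest w ws)
shortest⁺ pw []         = pw
shortest⁺ {w = w} {v ∷ _} pw (pv ∷ pvs) with length v <ᵇ length w
... | true  = shortest⁺ pv pvs
... | false = shortest⁺ pw pvs

-- Matchings and soundness of the search

record IsMatching {a ℓ} {A : Set a} (_~_ : Rel A ℓ) : Set (a ⊔ ℓ) where
  field
    irreflexive : Irreflexive _≡_ _~_
    symmetric   : Symmetric _~_
    unique      : ∀ {x y z} → x ~ y → x ~ z → y ≡ z

module _ {ℓ} {_~_ : Rel ℕ ℓ} (M : IsMatching _~_) where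
  open IsMatching M

  Hit : List ℕ → Set ℓ
  Hit w = ∃[ c ] ∃[ d ] (c ∈ w × d ∈ w × c ~ d)

  -- The pair that hits `w` cannot involve `a`, whose only partner `b` lies outside `w`; so both its
  -- cells survive.
  remove-Hit : ∀ {a b w} → a ~ b → ¬ b ∈ w → Hit w → Hit (remove a w)
  remove-Hit a~b b∉w (c , d , c∈ , d∈ , c~d) =
    c , d , ∈-remove⁺ c∈ c≢a , ∈-remove⁺ d∈ d≢a , c~d
    where
    c≢a : c ≢ _
    c≢a refl = b∉w (subst (_∈ _) (unique c~d a~b) d∈)
    d≢a : d ≢ _
    d≢a refl = b∉w (subst (_∈ _) (unique (symmetric c~d) a~b) c∈)

  commit-Hit : ∀ {a b} ws → a ~ b → All Hit ws → All Hit (commit a b ws)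
  commit-Hit [] a~b [] = []
  commit-Hit {a} {b} (w ∷ ws) a~b (h ∷ hs) with elem a w in a∉ | elem b w in b∉
  ... | true  | true  = commit-Hit ws a~b hs
  ... | true  | false = remove-Hit a~b (subst T b∉ ∘ ∈⇒elem) h ∷ commit-Hit ws a~b hs
  ... | false | _     =
    remove-Hit (symmetric a~b) (subst T a∉ ∘ ∈⇒elem) h ∷ commit-Hit ws a~b hs

  module _ {r} {R : Rel ℕ r} (R? : Decidable R) (~⇒R : ∀ {a b} → a ~ b → R a b) where

    -- Induction on the depth. Some pair of partners hits the shortest list, so in one of its two
    -- orders it is among the branches searched; committing to it keeps all remaining lists hit,
    -- against the refutation of that branch.
    refuted⇒¬Hit : ∀ n ws → refuted R? n ws ≡ true → ¬ All Hit ws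
    refuted⇒¬Hit (suc n) (w ∷ ws) ok (h ∷ hs) with shortest⁺ {P = Hit} h hs
    ... | c , d , c∈ , d∈ , c~d = go (∈-pairs⁺ c∈ d∈ (λ c≡d → irreflexive c≡d c~d))
      where
      branch : ∀ {a b} → a ~ b → ¬ (a , b) ∈ pairs (shortest w ws)
      branch a~b ab∈ = refuted⇒¬Hit n _
        (to T-≡ (All.lookup (all⁺ _ _ (from T-≡ ok))
          (∈-filter⁺ (λ (a , b) → R? a b) ab∈ (~⇒R a~b))))
        (commit-Hit (w ∷ ws) a~b (h ∷ hs))
      go : ¬ ((c , d) ∈ pairs (shortest w ws) ⊎ (d , c) ∈ pairs (shortest w ws))
      go (inj₁ cd∈) = branch c~d cd∈
      go (inj₂ dc∈) = branch (symmetric c~d) dc∈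

-- The board and the copies of Snaky on it

side : ℕ
side = 6

decode : ℕ → Cell
decode n = + (n % side) , + (n / side)

-- Inverse to `decode` on cells with x from 0 to 5 and nonnegative y; the absolute values make it
-- total.
encode : Cell → ℕ
encode (x , y) = ∣ x ∣ + side * ∣ y ∣

_≟_ : DecidableEquality Cell
_≟_ = ≡-dec ℤ._≟_ ℤ._≟_

Placement : Set
Placement = Bool × ℕ × ℕ × Fin 4

-- The image of the origin, a corner of the bounding box of Snaky. It lies on the board whenever the
-- copy does, so coordinates below `side` reach every copy on the board.
position : Placement → Cell
position (_ , y , x , _) = + x , + y

orient : Placement → Cell → Cell
orient (r , _ , _ , k) = rotate k ∘ reflect r

place : Placement → Cell → Cell
place p = translate (position p) ∘ orient p

-- The first condition puts x between 0 and 5 and makes y nonnegative.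
OnBoard : Cell → Set
OnBoard c = decode (encode c) ≡ c × encode c < side * side

onBoard? : U.Decidable OnBoard
onBoard? c = (decode (encode c) ≟ c) ×-dec (encode c ℕ.<? side * side)

Fits : Placement → Set
Fits p = All OnBoard (map (place p) snakyCells)

fits? : U.Decidable Fits
fits? p = all? onBoard? (map (place p) snakyCells)

-- Among equally short lists the search branches over the first, so the order of
-- the factors affects its size.
placements : List Placement
placements =
  cartesianProduct (false ∷ true ∷ [])
    (cartesianProduct (upTo side) (cartesianProduct (upTo side) (allFin 4)))

codes : Placement → List ℕ
codes p = map encode (map (place p) snakyCells)

copies : List (List ℕ)
copies = map codes (filter fits? placements)

decode-injective : ∀ {m n} → decode m ≡ decode n → m ≡ n
decode-injective {m} {n} eq with ,-injective eq
... | eq% , eq/ = trans (m≡m%n+[m/n]*n m side) (trans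
  (cong₂ (λ r q → r + q * side) (ℤ.+-injective eq%) (ℤ.+-injective eq/))
  (sym (m≡m%n+[m/n]*n n side)))

translate-injective : ∀ t {a b} → translate t a ≡ translate t b → a ≡ b
translate-injective (u , v) eq with ,-injective eq
... | eqx , eqy = cong₂ _,_ (∙-cancelˡ u _ _ eqx) (∙-cancelˡ v _ _ eqy)

translate-translate : ∀ s t c → translate s (translate t c) ≡ translate (translate s t) c
translate-translate (u , v) (u′ , v′) (x , y) =
  cong₂ _,_ (sym (ℤ.+-assoc u u′ x)) (sym (ℤ.+-assoc v v′ y))

translate-comm : ∀ s t c → translate s (translate t c) ≡ translate t (translate s c)
translate-comm s t c = trans (translate-translate s t c) (trans
  (cong (λ u → translate u c)
    (cong₂ _,_ (ℤ.+-comm (proj₁ s) (proj₁ t)) (ℤ.+-comm (proj₂ s) (proj₂ t))))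
  (sym (translate-translate t s c)))

difference : Cell → Cell → Cell
difference (x , y) (u , v) = x -ᶻ u , y -ᶻ v

translate-difference : ∀ c d → translate (difference c d) d ≡ c
translate-difference (x , y) (u , v) = cong₂ _,_ (//-rightDividesˡ u x) (//-rightDividesˡ v y)

unconstrained? : Decidable {A = ℕ} {B = ℕ} (λ _ _ → ⊤)
unconstrained? _ _ = yes tt

-- The partner relation of a winning pairing

module _ {ℓ} {𝓟 : Family Cell ℓ} (winning : IsWinningPairing (IsIsomorphicCopy Snaky) 𝓟) where
  open IsWinningPairing winning

  Partners : Rel Cell (lsuc 0ℓ ⊔ ℓ)
  Partners a b = a ≢ b × ∃[ P ] (𝓟 P × P a × P b)

  -- Pigeonhole: `y` and `z` are both the element of `P` other than `x`.
  other-unique : ∀ {P : Subset Cell} {x y z} → IsTwoElement P →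
                 P x → P y → P z → x ≢ y → x ≢ z → y ≡ z
  other-unique (a , b , _ , P⊆ , _) x∈ y∈ z∈ x≢y x≢z with P⊆ x∈ | P⊆ y∈ | P⊆ z∈
  ... | _         | inj₁ refl | inj₁ refl = refl
  ... | _         | inj₂ refl | inj₂ refl = refl
  ... | inj₁ refl | inj₁ refl | inj₂ _    = ⊥-elim (x≢y refl)
  ... | inj₂ refl | inj₁ _    | inj₂ refl = ⊥-elim (x≢z refl)
  ... | inj₁ refl | inj₂ _    | inj₁ refl = ⊥-elim (x≢z refl)
  ... | inj₂ refl | inj₂ refl | inj₁ _    = ⊥-elim (x≢y refl)

  partners-isMatching : IsMatching Partners
  partners-isMatching = record
    { irreflexive = λ a≡b (a≢b , _) → a≢b a≡b
    ; symmetric   = λ (a≢b , P , P∈ , a∈ , b∈) → a≢b ∘ sym , P , P∈ , b∈ , a∈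
    ; unique      = λ {_} {y} {z} (x≢y , P , P∈ , xP , yP) (x≢z , Q , Q∈ , xQ , zQ) →
        -- Equality of sets need not be decidable, but equality of cells is. If `y` and `z` differ,
        -- then so do `P` and `Q`, yet they share `x`.
        decidable-stable (y ≟ z) λ y≢z →
          pairwiseDisjoint P Q P∈ Q∈
            (λ (_ , Q⊆P) → y≢z (other-unique (twoElement P P∈) xP yP (Q⊆P zQ) x≢y x≢z))
            (xP , xQ)
    }

  module _ (t : Cell) where

    board : ℕ → Cell
    board = translate t ∘ decode

    board-isMatching : IsMatching (λ m n → Partners (board m) (board n))
    board-isMatching = record
      { irreflexive = λ m≡n → irreflexive (cong board m≡n)
      ; symmetric   = symmetric
      ; unique      = λ p q → decode-injective (translate-injective t (unique p q))
      }
      where open IsMatching partners-isMatching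

    -- `Fits` supplies the round trip through `encode` and `decode`, so each cell of the shifted
    -- copy is recovered from its code.
    board-code : ∀ {p} → Fits p → ∀ {c} →
                 image (translate (translate t (position p)) ∘ orient p) Snaky c →
                 ∃[ n ] (n ∈ codes p × c ≡ board n)
    board-code {p} fits (s , s∈ , refl) =
      encode (place p s) , ∈-map⁺ encode (∈-map⁺ (place p) s∈) ,
      trans (sym (translate-translate t (position p) (orient p s)))
            (cong (translate t) (sym (proj₁ (All.lookup fits (∈-map⁺ (place p) s∈)))))

    fits⇒Hit : ∀ {p} → Fits p → Hit board-isMatching (codes p)
    fits⇒Hit {p@(r , _ , _ , k)} fits
      -- The winning set is the image itself, so both inclusions are identities.
      with hits _ (translate t (position p) , k , r , (λ z → z) , (λ z → z))
    ... | P , P∈ , P⊆ with twoElement P P∈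
    ... | a , b , a≢b , _ , ⊆P
      with board-code {p} fits (P⊆ (⊆P (inj₁ refl))) | board-code {p} fits (P⊆ (⊆P (inj₂ refl)))
    ... | c , c∈ , refl | d , d∈ , refl =
      c , d , c∈ , d∈ , a≢b , P , P∈ , ⊆P (inj₁ refl) , ⊆P (inj₂ refl)

    map-codes-Hit : ∀ ps → All Fits ps → All (Hit board-isMatching) (map codes ps)
    map-codes-Hit ps fits = map⁺ (All.map (λ {p} → fits⇒Hit {p}) fits)

    copies-Hit : All (Hit board-isMatching) copies
    copies-Hit = map-codes-Hit (filter fits? placements) (all-filter fits? placements)

    board-translate : ∀ e {m n} → decode n ≡ translate e (decode m) →
                      board n ≡ translate e (board m)
    board-translate e {m} {n} eq = trans (cong (translate t) eq) (translate-comm t e (decode m))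

  -- If `c` and its shift by `e` were partners, the board could be placed with the cell of `m` on
  -- `c`; the cell of `n` then falls on the shift, and the search refutes this commitment.
  no-partner-at : ∀ e {m n} → decode n ≡ translate e (decode m) →
                  refuted unconstrained? (side * side) (commit m n copies) ≡ true →
                  ∀ c → ¬ Partners c (translate e c)
  no-partner-at e {m} {n} eq ok c c~e+c =
    -- Each commitment uses up two of the 36 cells, so depth `side * side` is ample.
    refuted⇒¬Hit M unconstrained? (λ _ → tt) (side * side) (commit m n copies) ok
      (commit-Hit M {m} {n} copies m~n (copies-Hit t))
    where
    t = difference c (decode m)
    M = board-isMatching t
    m~n : Partners (board t m) (board t n)
    m~n = subst (Partners (board t m)) (sym (board-translate t e {m} {n} eq))
      (subst (λ b → Partners b (translate e b)) (sym (translate-difference c (decode m))) c~e+c)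

-- Exclusion of dominoes and the final search

right up : Cell
right = + 1 , + 0
up    = + 0 , + 1

Domino : Rel Cell _
Domino a b = b ≡ translate right a ⊎ b ≡ translate up a

-- `Domino` is directed, while the search meets each pair in one arbitrary order, so both directions
-- are tested.
NotDomino : Rel ℕ _
NotDomino m n = ¬ Domino (decode m) (decode n) × ¬ Domino (decode n) (decode m)

domino? : Decidable Domino
domino? a b = (b ≟ translate right a) ⊎-dec (b ≟ translate up a)

notDomino? : Decidable NotDomino
notDomino? m n = ¬? (domino? (decode m) (decode n)) ×-dec ¬? (domino? (decode n) (decode m))

-- The codes 27, 28 and 21, 27 stand for (3, 4), (4, 4) and (3, 3), (3, 4).
right-refuted : refuted unconstrained? (side * side) (commit 27 28 copies) ≡ true
right-refuted = refl

up-refuted : refuted unconstrained? (side * side) (commit 21 27 copies) ≡ true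
up-refuted = refl

notDomino-refuted : refuted notDomino? (side * side) copies ≡ true
notDomino-refuted = refl

theorem8 : (ℓ : Level) → ¬ HasWinningPairing ℓ (IsIsomorphicCopy Snaky)
theorem8 ℓ (𝓟 , winning) =
  refuted⇒¬Hit M notDomino?
    (λ {m} {n} m~n → notDomino m n m~n , notDomino n m (symmetric {m} {n} m~n))
    (side * side) copies notDomino-refuted (copies-Hit winning origin)
  where
  -- Dominoes are excluded everywhere in the grid, so any position of the board serves here.
  origin = + 0 , + 0
  M = board-isMatching winning origin
  open IsMatching M using (symmetric)
  notDomino : ∀ m n → Partners winning (board winning origin m) (board winning origin n) →
              ¬ Domino (decode m) (decode n)
  notDomino m n m~n (inj₁ eq) = no-partner-at winning right {27} {28} refl right-refuted _
    (subst (Partners winning _) (board-translate winning origin right {m} {n} eq) m~n)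
  notDomino m n m~n (inj₂ eq) = no-partner-at winning up {21} {27} refl up-refuted _
    (subst (Partners winning _) (board-translate winning origin up {m} {n} eq) m~n)
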